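{- Let $n$ be an integer with $n\geq 13$. If $n\equiv 0,1,4\pmod 6$, then $\gamma^{LD}(C_n(1,3))=\lceil n/3\rceil$, and otherwise $\gamma^{LD}(C_n(1,3))=\lceil n/3\rceil+1$.
   Context: For a positive integer $n$, the circulant graph $C_n(1,3)$ has vertex set $\mathbb{Z}_n$, and $u$ is adjacent to $u\pm1$ and $u\pm 3$ (modulo $n$); $N[u]=\{u,u\pm1,u\pm3\}$. For a code (nonempty subset) $C\subseteq\mathbb{Z}_n$, $I(C;u)=N[u]\cap C$. $C$ is locating-dominating if $I(C;u)\neq\emptyset$ for all vertices $u$ and $I(C;u)\neq I(C;v)$ for all distinct $u,v\in\mathbb{Z}_n\setminus C$. $\gamma^{LD}(G)$ is the minimum cardinality of a locating-dominating code in $G$. -}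

module Defs where

open import Data.Nat using (ℕ; suc; _+_; _∸_; _≤_; _/_; _%_; NonZero)
open import Data.Fin using (Fin; toℕ)
open import Data.Fin.Subset using (Subset; _∈_; _∉_; ∣_∣; Nonempty)
open import Data.Product using (Σ; _×_; ∃)
open import Data.Sum using (_⊎_)
open import Relation.Binary.PropositionalEquality using (_≡_; _≢_)
open import Relation.Nullary using (¬_)

-- Vertices of C_n(1,3) are Fin n, identified with ℤ_n via toℕ.
-- Closed neighbourhood: v ∈ N[u] iff v ≡ u, u±1, u±3 (mod n).
-- u - d is computed as u + (n - d mod n) to stay in ℕ.
module _ (n : ℕ) .{{_ : NonZero n}} where

  _⊕_ : ℕ → ℕ → ℕ
  a ⊕ b = (a + b) % n

  _⊖_ : ℕ → ℕ → ℕ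
  a ⊖ b = (a + (n ∸ (b % n))) % n

  InClosedNbhd : Fin n → Fin n → Set
  InClosedNbhd u v =
      toℕ v ≡ toℕ u % n
    ⊎ toℕ v ≡ toℕ u ⊕ 1
    ⊎ toℕ v ≡ toℕ u ⊖ 1
    ⊎ toℕ v ≡ toℕ u ⊕ 3
    ⊎ toℕ v ≡ toℕ u ⊖ 3

  Dominated : Subset n → Fin n → Set
  Dominated C u = ∃ λ v → InClosedNbhd u v × v ∈ C

  Separated : Subset n → Fin n → Fin n → Set
  Separated C u w = ∃ λ v → v ∈ C ×
    ((InClosedNbhd u v × ¬ InClosedNbhd w v) ⊎ (¬ InClosedNbhd u v × InClosedNbhd w v))

  IsLocatingDominating : Subset n → Set
  IsLocatingDominating C =
      Nonempty C
    × (∀ u → Dominated C u)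
    × (∀ u w → u ∉ C → w ∉ C → u ≢ w → Separated C u w)

  γLD≡ : ℕ → Set
  γLD≡ k = (Σ (Subset n) λ C → IsLocatingDominating C × ∣ C ∣ ≡ k)
         × (∀ C → IsLocatingDominating C → k ≤ ∣ C ∣)

⌈_/3⌉ : ℕ → ℕ
⌈ n /3⌉ = (n + 2) / 3

{-# OPTIONS --safe #-}

-- For n ≥ 13 a code is locating-dominating iff it hits all translates of N[0] and, for 1 ≤ d ≤ 6, of
-- the symmetric difference of N[0] and N[d] together with 0 and d.
--
-- Lower bound: N[0] and the sets for d = 2, 4 suffice.  Viewing the code as a closed walk on states
-- of ten bits, there is a potential that turns the cost 3 [i ∈ C] - 1 of every step into a
-- nonnegative excess, hence 3 |C| = n + (total excess) ≥ n.  If all steps are tight (of excess 0),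
-- the walk has period 6; for n ≡ 3 (mod 6) it would then have period 3, which is impossible.  A step
-- of excess 1 cannot lie between 13 tight steps before it and 12 after it, so the total excess is
-- never 1 for n ≥ 14.  Residues mod 3 do the rest.
--
-- Upper bound: repetitions of 001100 preceded by a patch of length 1 to 6.

module Submission where

open import Defs
open import Data.Bool using (Bool; true; false; T; not; _∧_; _∨_; _xor_; if_then_else_)
open import Data.Bool.ListAction using (any; all)
open import Data.Bool.Properties using (T-∧; T-∨; T-≡; T?)
open import Data.Empty using (⊥-elim)
open import Data.Fin using (Fin; toℕ) renaming (zero to fzero; suc to fsuc)
open import Data.Fin.Properties using (toℕ-fromℕ<; toℕ-injective; toℕ<n)
open import Data.Fin.Subset using (Subset; _∈_; _∉_; ∣_∣)
open import Data.List using (List; []; _∷_; _++_; concat; filter; foldl; length; replicate; upTo)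
open import Data.List.Membership.Propositional using (find; lose) renaming (_∈_ to _∈ˡ_)
open import Data.List.Membership.Propositional.Properties using (∈-upTo⁺; ∈-upTo⁻; ∈-filter⁺; ∈-filter⁻)
open import Data.List.Properties using (++-assoc; length-++)
open import Data.List.Relation.Unary.All as All using ()
open import Data.List.Relation.Unary.All.Properties using (all⁺; all⁻)
open import Data.List.Relation.Unary.Any using (here; there)
open import Data.List.Relation.Unary.Any.Properties using (any⁺; any⁻)
open import Data.Nat
open import Data.Nat.DivMod
open import Data.Nat.Divisibility using (divides)
open import Data.Nat.Properties
open import Data.Nat.Solver using (module +-*-Solver)
open import Data.Product using (_×_; _,_; proj₁; proj₂; ∃-syntax)
open import Data.Sum using (_⊎_; inj₁; inj₂)
open import Data.Unit using (⊤; tt)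
open import Data.Vec using (Vec; []; _∷_; _∷ʳ_; head; tail; toList; lookup; tabulate)
open import Data.Vec.Properties using ([]=⇒lookup; lookup⇒[]=; lookup∘tabulate)
open import Function using (_∘_; Equivalence)
open import Relation.Binary.PropositionalEquality
open import Relation.Nullary using (¬_; Dec; yes; no)
open import Relation.Nullary.Decidable using (_⊎-dec_)

open Equivalence using (to; from)

-- Bits, hitting sets and residue classes

bit : Bool → ℕ
bit false = 0
bit true  = 1

bitAt : List Bool → ℕ → Bool
bitAt []       _       = false
bitAt (x ∷ _)  zero    = x
bitAt (_ ∷ xs) (suc j) = bitAt xs j

hits : List ℕ → (ℕ → Bool) → ℕ → Bool
hits S b i = any (λ j → b (j + i)) S

Ordinary : ℕ → Set
Ordinary r = r ≡ 0 ⊎ r ≡ 1 ⊎ r ≡ 4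

-- Finite sums and periodic sequences

Σ< : ℕ → (ℕ → ℕ) → ℕ
Σ< zero    f = 0
Σ< (suc n) f = f 0 + Σ< n (f ∘ suc)

Periodic : ∀ {A : Set} → ℕ → (ℕ → A) → Set
Periodic n f = ∀ i → f (i + n) ≡ f i

Σ<-snoc : ∀ n f → Σ< (suc n) f ≡ Σ< n f + f n
Σ<-snoc zero    f = +-comm (f 0) 0
Σ<-snoc (suc n) f = trans (cong (f 0 +_) (Σ<-snoc n (f ∘ suc))) (sym (+-assoc (f 0) _ _))

-- Rotation by one drops `f 0` and appends `f n`, which periodicity identifies with `f 0`.
Σ<-rotate : ∀ {n f} → Periodic n f → ∀ i → Σ< n (λ j → f (i + j)) ≡ Σ< n f
Σ<-rotate         per zero    = refl
Σ<-rotate {n} {f} per (suc i) = trans (Σ<-rotate (per ∘ suc) i) (+-cancelˡ-≡ (f 0) _ _ (begin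
  f 0 + Σ< n (f ∘ suc)  ≡⟨ Σ<-snoc n f ⟩
  Σ< n f + f n          ≡⟨ cong (Σ< n f +_) (per 0) ⟩
  Σ< n f + f 0          ≡⟨ +-comm _ (f 0) ⟩
  f 0 + Σ< n f          ∎))
  where open ≡-Reasoning

Σ<≡0⇒≡0 : ∀ {n f} → Σ< n f ≡ 0 → ∀ j → j < n → f j ≡ 0
Σ<≡0⇒≡0 {suc n} {f} eq zero    _         = m+n≡0⇒m≡0 (f 0) eq
Σ<≡0⇒≡0 {suc n} {f} eq (suc j) (s≤s j<n) = Σ<≡0⇒≡0 (m+n≡0⇒n≡0 (f 0) eq) j j<n

Σ<≡1⇒∃≡1 : ∀ {n f} → Σ< n f ≡ 1 → ∃[ i ] f i ≡ 1
Σ<≡1⇒∃≡1 {suc n} {f} eq with f 0 in f0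
... | zero        = let i , fi = Σ<≡1⇒∃≡1 {n} eq in suc i , fi
... | suc zero    = 0 , f0
... | suc (suc _) with () ← eq

-- Rotated to start at `i`, the sum begins with the summand 1, so the remaining `n - 1` summands add
-- up to 0.
Σ<≡1⇒others≡0 : ∀ {n f} → Periodic n f → Σ< n f ≡ 1 → ∀ i → f i ≡ 1 →
                 ∀ j → suc j < n → f (i + suc j) ≡ 0
Σ<≡1⇒others≡0 {suc n} {f} per total i fi≡1 j (s≤s j<n) = Σ<≡0⇒≡0 {n} (suc-injective (begin
  1 + S                         ≡⟨ cong (_+ S) (trans (cong f (+-identityʳ i)) fi≡1) ⟨
  Σ< (suc n) (λ j → f (i + j))  ≡⟨ Σ<-rotate per i ⟩
  Σ< (suc n) f                  ≡⟨ total ⟩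
  1                             ∎)) j j<n
  where
  open ≡-Reasoning
  S = Σ< n (λ j → f (i + suc j))

-- Adding up the balance equations cancels the intermediate values of `u`. On a closed walk `u 0`
-- and `u n` agree too, which leaves length plus total excess equal to three times the weight.
telescope : ∀ (u e c : ℕ → ℕ) → (∀ i → u i + 1 + e i ≡ u (suc i) + 3 * c i) →
            ∀ n → u 0 + n + Σ< n e ≡ u n + 3 * Σ< n c
telescope u e c bal zero    = +-assoc _ 0 0
telescope u e c bal (suc n) = begin
  u 0 + suc n + (e 0 + E)        ≡⟨ regroup₁ (u 0) n (e 0) E ⟩
  (u 0 + 1 + e 0) + (n + E)      ≡⟨ cong (_+ (n + E)) (bal 0) ⟩
  u 1 + 3 * c 0 + (n + E)        ≡⟨ regroup₂ (u 1) (c 0) n E ⟩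
  u 1 + n + E + 3 * c 0          ≡⟨ cong (_+ 3 * c 0) (telescope (u ∘ suc) (e ∘ suc) (c ∘ suc) (bal ∘ suc) n) ⟩
  u (suc n) + 3 * F + 3 * c 0    ≡⟨ regroup₃ (u (suc n)) F (c 0) ⟩
  u (suc n) + 3 * (c 0 + F)      ∎
  where
  open ≡-Reasoning
  open +-*-Solver
  E = Σ< n (e ∘ suc)
  F = Σ< n (c ∘ suc)
  regroup₁ : ∀ a b c d → a + suc b + (c + d) ≡ (a + 1 + c) + (b + d)
  regroup₁ = solve 4 (λ a b c d → a :+ (con 1 :+ b) :+ (c :+ d) := (a :+ con 1 :+ c) :+ (b :+ d)) refl
  regroup₂ : ∀ a b c d → a + 3 * b + (c + d) ≡ a + c + d + 3 * b
  regroup₂ = solve 4 (λ a b c d → a :+ con 3 :* b :+ (c :+ d) := a :+ c :+ d :+ con 3 :* b) refl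
  regroup₃ : ∀ a b c → a + 3 * b + 3 * c ≡ a + 3 * (c + b)
  regroup₃ = solve 3 (λ a b c → a :+ con 3 :* b :+ con 3 :* c := a :+ con 3 :* (c :+ b)) refl

-- Exhaustive checks on binary words

both : (Bool → Bool) → Bool
both p = p false ∧ p true

both⁻ : ∀ p → T (both p) → ∀ x → T (p x)
both⁻ p h false = proj₁ (to T-∧ h)
both⁻ p h true  = proj₂ (to T-∧ h)

allVec : ∀ m → (Vec Bool m → Bool) → Bool
allVec zero    p = p []
allVec (suc m) p = both λ x → allVec m (p ∘ (x ∷_))

allVec⁻ : ∀ m p → allVec m p ≡ true → ∀ v → T (p v)
allVec⁻ zero    p eq []      = from T-≡ eq
allVec⁻ (suc m) p eq (x ∷ v) = allVec⁻ m (p ∘ (x ∷_))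
  (to T-≡ (both⁻ (λ y → allVec m (p ∘ (y ∷_))) (from T-≡ eq) x)) v

infixr 4 _⇒_
_⇒_ : Bool → Bool → Bool
x ⇒ y = not x ∨ y

⇒⁻ : ∀ {x y} → T (x ⇒ y) → T x → T y
⇒⁻ {true} h _ = h

window : (ℕ → Bool) → ℕ → ∀ m → Vec Bool m
window b i zero    = []
window b i (suc m) = b i ∷ window b (suc i) m

window-periodic : ∀ {d b} m → Periodic d b → Periodic d (λ i → window b i m)
window-periodic zero    per i = refl
window-periodic (suc m) per i = cong₂ _∷_ (per i) (window-periodic m per (suc i))

-- States, potentials and excess

-- The state at a position consists of the next ten bits; reading one more bit gives a window of
-- eleven bits, and hence the next state.
State : Set
State = Vec Bool 10

-- The three lists are offsets, separators 2 and separators 4 below.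
legal : Vec Bool 11 → Bool
legal w = hits (0 ∷ 2 ∷ 3 ∷ 4 ∷ 6 ∷ []) (bitAt (toList w)) 0
        ∧ hits (0 ∷ 3 ∷ 5 ∷ 8 ∷ []) (bitAt (toList w)) 0
        ∧ hits (0 ∷ 2 ∷ 3 ∷ 7 ∷ 8 ∷ 10 ∷ []) (bitAt (toList w)) 0

Legal : (ℕ → Bool) → Set
Legal b = ∀ i → T (legal (window b i 11))

-- In a closed walk of length 14 with total excess 1, exactly 13 tight steps precede each return of
-- the exceptional step; hence the 13. The pattern occurs in every longer closed walk of total
-- excess 1 as well.
isolatedExcess : List ℕ
isolatedExcess = replicate 13 0 ++ 1 ∷ replicate 12 0

module _ (Q : State → ℕ) where

  next : State → Bool → State
  next s x = tail (s ∷ʳ x)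

  -- The bit charged is `head s`, the one that leaves the state. On legal edges `isPotential` rules
  -- out truncation of the difference.
  excess : State → Bool → ℕ
  excess s x = (Q (next s x) + 3 * bit (head s)) ∸ (Q s + 1)

  isPotential : State → Bool
  isPotential s = both λ x → legal (s ∷ʳ x) ⇒ (Q s + 1 ≤ᵇ Q (next s x) + 3 * bit (head s))

  -- With `p` constantly false this says that no legal path from `s` has the excess sequence `rs`.
  paths : List ℕ → (State → Bool) → State → Bool
  paths []       p s = p s
  paths (r ∷ rs) p s = both λ x → legal (s ∷ʳ x) ⇒ (excess s x ≡ᵇ r) ⇒ paths rs p (next s x)

  -- Applied after eight tight steps; the first alternative discards paths that get stuck within
  -- six more tight steps.
  stuckOrRepeats : State → Bool
  stuckOrRepeats s = paths (replicate 6 0) (λ _ → false) s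
                   ∨ (bit (bitAt (toList s) 0) ≡ᵇ bit (bitAt (toList s) 6))

  certified : State → Bool
  certified s = isPotential s ∧ paths isolatedExcess (λ _ → false) s ∧ paths (replicate 8 0) stuckOrRepeats s

Follows : (ℕ → ℕ) → List ℕ → ℕ → Set
Follows e []       i = ⊤
Follows e (r ∷ rs) i = e i ≡ r × Follows e rs (suc i)

-- The interface between the finite check and the summation argument, which never looks at the
-- potential itself. Periodicity is stated for every `d` because `u-periodic` is applied with the
-- periods `n` and 3.
record Discharging (b : ℕ → Bool) : Set where
  field
    u e              : ℕ → ℕ
    u-periodic       : ∀ {d} → Periodic d b → Periodic d u
    e-periodic       : ∀ {d} → Periodic d b → Periodic d e
    balance          : ∀ i → u i + 1 + e i ≡ u (suc i) + 3 * bit (b i)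
    noIsolatedExcess : ∀ i → ¬ Follows e isolatedExcess i
    tight-repeats    : (∀ i → e i ≡ 0) → ∀ i → b (8 + i) ≡ b (14 + i)
    hits-0358        : ∀ i → T (hits (0 ∷ 3 ∷ 5 ∷ 8 ∷ []) b i)

follows-zeros : ∀ e m rs i → (∀ j → j < m → e (i + j) ≡ 0) → Follows e rs (m + i) → Follows e (replicate m 0 ++ rs) i
follows-zeros e zero    rs i zs fs = fs
follows-zeros e (suc m) rs i zs fs =
  subst (λ k → e k ≡ 0) (+-identityʳ i) (zs 0 z<s) ,
  follows-zeros e m rs (suc i)
    (λ j j<m → subst (λ k → e k ≡ 0) (+-suc i j) (zs (suc j) (s<s j<m)))
    (subst (Follows e rs) (sym (+-suc m i)) fs)

module LegalSequence (Q : State → ℕ) (certify : ∀ s → T (certified Q s))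
                     {b : ℕ → Bool} (b-legal : Legal b) where

  parts : ∀ s → T (isPotential Q s) × T (paths Q isolatedExcess (λ _ → false) s)
              × T (paths Q (replicate 8 0) (stuckOrRepeats Q) s)
  parts s = let p , qr = to (T-∧ {isPotential Q s}) (certify s) in
    p , to (T-∧ {paths Q isolatedExcess (λ _ → false) s}) qr

  state : ℕ → State
  state i = window b i 10

  e : ℕ → ℕ
  e i = excess Q (state i) (b (10 + i))

  balance : ∀ i → Q (state i) + 1 + e i ≡ Q (state (suc i)) + 3 * bit (b i)
  -- `state i ∷ʳ b (10 + i)` computes to `window b i 11`, so `b-legal i` is the legality premise of
  -- this edge.
  balance i = m+[n∸m]≡n (≤ᵇ⇒≤ (Q (state i) + 1) _
    (⇒⁻ (both⁻ edge (proj₁ (parts (state i))) (b (10 + i))) (b-legal i)))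
    where
    edge : Bool → Bool
    edge x = legal (state i ∷ʳ x) ⇒ (Q (state i) + 1 ≤ᵇ Q (next Q (state i) x) + 3 * bit (b i))

  -- The end position is a fold so that it agrees definitionally with that of the recursive call at
  -- `suc i`; for `replicate 8 0` it computes to `8 + i`.
  paths⁻ : ∀ rs p i → T (paths Q rs p (state i)) → Follows e rs i → T (p (state (foldl (λ k _ → suc k) i rs)))
  paths⁻ []       p i h _          = h
  paths⁻ (r ∷ rs) p i h (eq , eqs) = paths⁻ rs p (suc i)
    (⇒⁻ (⇒⁻ (both⁻ edge h (b (10 + i))) (b-legal i)) (≡⇒≡ᵇ _ _ eq)) eqs
    where
    edge : Bool → Bool
    edge x = legal (state i ∷ʳ x) ⇒ (excess Q (state i) x ≡ᵇ r) ⇒ paths Q rs p (next Q (state i) x)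

  discharging : Discharging b
  discharging = record
    { u                = Q ∘ state
    ; e                = e
    ; u-periodic       = λ per i → cong Q (window-periodic 10 per i)
    ; e-periodic       = λ per i → cong₂ (excess Q) (window-periodic 10 per i) (per (10 + i))
    ; balance          = balance
    ; noIsolatedExcess = λ i → paths⁻ isolatedExcess (λ _ → false) i (proj₁ (proj₂ (parts (state i))))
    ; tight-repeats    = λ tight i → repeats tight i
        (to T-∨ (paths⁻ (replicate 8 0) (stuckOrRepeats Q) i (proj₂ (proj₂ (parts (state i)))) (zeros tight 8 i)))
    ; hits-0358        = λ i → proj₁ (to T-∧ (proj₂ (to (T-∧ {hits (0 ∷ 2 ∷ 3 ∷ 4 ∷ 6 ∷ []) b i}) (b-legal i))))
    }
    where
    zeros : (∀ i → e i ≡ 0) → ∀ m j → Follows e (replicate m 0) j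
    zeros tight zero    j = tt
    zeros tight (suc m) j = tight j , zeros tight m (suc j)
    bit-injective : ∀ x y → bit x ≡ bit y → x ≡ y
    bit-injective false false _ = refl
    bit-injective true  true  _ = refl
    repeats : (∀ i → e i ≡ 0) → ∀ i →
              T (paths Q (replicate 6 0) (λ _ → false) (state (8 + i))) ⊎ T (bit (b (8 + i)) ≡ᵇ bit (b (14 + i))) →
              b (8 + i) ≡ b (14 + i)
    -- The sequence goes on for six more tight steps, so its path does not get stuck.
    repeats tight i (inj₁ stuck) = ⊥-elim (paths⁻ (replicate 6 0) (λ _ → false) (8 + i) stuck (zeros tight 6 (8 + i)))
    repeats tight i (inj₂ same)  = bit-injective _ _ (≡ᵇ⇒≡ _ _ same)

-- Lower bound on the weight of a periodic sequence

module LowerBound {b} (D : Discharging b) where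

  open Discharging D

  -- Modulo 3 the offsets 0, 3, 5, 8 are 0 and 2, so any two of the three residues include a
  -- codeword and at least two residues are occupied. Telescoping over one period of tight steps
  -- allows only one.
  three-periodic-not-tight : Periodic 3 b → ¬ (∀ i → e i ≡ 0)
  three-periodic-not-tight per tight = one-of-three (b 0) (b 1) (b 2) (pair 0) one₁ one₂ total
    where
    pair : ∀ i → T (b i ∨ b (2 + i))
    pair i = simplify (b i) (b (2 + i)) (subst T (cong₂ (λ x y → b i ∨ x ∨ y) (per′ 0) (cong₂ _∨_ (per′ 2)
      (cong (_∨ false) (trans (per′ 5) (per′ 2))))) (hits-0358 i))
      where
      per′ : ∀ j → b (3 + (j + i)) ≡ b (j + i)
      per′ j = trans (cong b (+-comm 3 (j + i))) (per (j + i))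
      simplify : ∀ x y → T (x ∨ x ∨ y ∨ y ∨ false) → T (x ∨ y)
      simplify true  _    _ = tt
      simplify false true _ = tt
    one₁ : T (b 1 ∨ b 0)
    one₁ = subst (λ x → T (b 1 ∨ x)) (per 0) (pair 1)
    one₂ : T (b 2 ∨ b 1)
    one₂ = subst (λ x → T (b 2 ∨ x)) (per 1) (pair 2)
    total : Σ< 3 (bit ∘ b) ≡ 1
    total = *-cancelˡ-≡ _ 1 3 (+-cancelˡ-≡ (u 0) _ 3 (begin
      u 0 + 3 * Σ< 3 (bit ∘ b)  ≡⟨ cong (_+ 3 * Σ< 3 (bit ∘ b)) (u-periodic per 0) ⟨
      u 3 + 3 * Σ< 3 (bit ∘ b)  ≡⟨ telescope u e (bit ∘ b) balance 3 ⟨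
      u 0 + 3 + Σ< 3 e          ≡⟨ cong (u 0 + 3 +_) (cong₂ _+_ (tight 0) (cong₂ _+_ (tight 1) (cong (_+ 0) (tight 2)))) ⟩
      u 0 + 3 + 0               ≡⟨ +-identityʳ _ ⟩
      u 0 + 3                   ∎))
      where open ≡-Reasoning
    one-of-three : ∀ x y z → T (x ∨ z) → T (y ∨ x) → T (z ∨ y) → bit x + (bit y + (bit z + 0)) ≢ 1
    one-of-three true  true  true  _ _ _ ()
    one-of-three true  true  false _ _ _ ()
    one-of-three true  false true  _ _ _ ()
    one-of-three false true  true  _ _ _ ()

  module Weight {n} (13≤n : 13 ≤ n) (b-periodic : Periodic n b) where

    e-per : Periodic n e
    e-per = e-periodic b-periodic

    weight-excess : n + Σ< n e ≡ 3 * Σ< n (bit ∘ b)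
    weight-excess = +-cancelˡ-≡ (u 0) _ _ (begin
      u 0 + (n + Σ< n e)        ≡⟨ +-assoc (u 0) n _ ⟨
      u 0 + n + Σ< n e          ≡⟨ telescope u e (bit ∘ b) balance n ⟩
      u n + 3 * Σ< n (bit ∘ b)  ≡⟨ cong (_+ 3 * Σ< n (bit ∘ b)) (u-periodic b-periodic 0) ⟩
      u 0 + 3 * Σ< n (bit ∘ b)  ∎)
      where open ≡-Reasoning

    excess≢1 : 14 ≤ n → Σ< n e ≢ 1
    -- Here `suc k` is `n - 13`: the pattern starts 13 positions before `i + n`, the next occurrence
    -- of the exceptional step.
    excess≢1 14≤n total = noIsolatedExcess (i + suc k)
      (follows-zeros e 13 (1 ∷ replicate 12 0) (i + suc k) before
        (trans (cong e shift) (trans (e-per i) ei≡1) ,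
         follows-zeros e 12 [] (14 + (i + suc k)) after tt))
      where
      open +-*-Solver
      k = n ∸ 14
      14+k≡n : 14 + k ≡ n
      14+k≡n = m+[n∸m]≡n 14≤n
      i = proj₁ (Σ<≡1⇒∃≡1 {n} total)
      ei≡1 : e i ≡ 1
      ei≡1 = proj₂ (Σ<≡1⇒∃≡1 {n} total)
      others : ∀ j → suc j < n → e (i + suc j) ≡ 0
      others = Σ<≡1⇒others≡0 e-per total i ei≡1
      shift : 13 + (i + suc k) ≡ i + n
      shift = trans (solve 2 (λ i k → con 13 :+ (i :+ (con 1 :+ k)) := i :+ (con 14 :+ k)) refl i k) (cong (i +_) 14+k≡n)
      before : ∀ j → j < 13 → e (i + suc k + j) ≡ 0
      before j j<13 = trans (cong e (+-assoc i (suc k) j)) (others (k + j)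
        (subst (suc (k + j) <_) (trans (+-comm (suc k) 13) (trans (+-suc 13 k) 14+k≡n)) (+-monoʳ-< (suc k) j<13)))
      after : ∀ j → j < 12 → e (14 + (i + suc k) + j) ≡ 0
      after j j<12 = trans (cong e regroup) (trans (e-per (i + suc j))
        (others j (≤-trans (s≤s j<12) (≤-trans (m≤m+n 13 1) 14≤n))))
        where
        regroup : 14 + (i + suc k) + j ≡ i + suc j + n
        regroup = trans
          (solve 3 (λ i k j → con 14 :+ (i :+ (con 1 :+ k)) :+ j := i :+ (con 1 :+ j) :+ (con 14 :+ k)) refl i k j)
          (cong (i + suc j +_) 14+k≡n)

    tight : Σ< n e ≡ 0 → ∀ i → e i ≡ 0
    tight total i = trans (cong e (sym (+-identityʳ i)))
      (Σ<≡0⇒≡0 {n} (trans (Σ<-rotate e-per i) total) 0 (≤-trans z<s 13≤n))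

    six-periodic : Σ< n e ≡ 0 → Periodic 6 b
    -- `tight-repeats` speaks of positions from 8 on, so both sides are first moved by one period
    -- `n = 8 + m`.
    six-periodic total i with m , refl ← m≤n⇒∃[o]m+o≡n (≤-trans (m≤n+m 8 5) 13≤n) = begin
      b (i + 6)              ≡⟨ b-periodic (i + 6) ⟨
      b (i + 6 + (8 + m))    ≡⟨ cong b (regroup i m 6) ⟩
      b (8 + (6 + (i + m)))  ≡⟨ tight-repeats (tight total) (i + m) ⟨
      b (8 + (i + m))        ≡⟨ cong b (regroup₀ i m) ⟨
      b (i + (8 + m))        ≡⟨ b-periodic i ⟩
      b i                    ∎
      where
      open ≡-Reasoning
      open +-*-Solver
      regroup : ∀ i m c → i + c + (8 + m) ≡ 8 + (c + (i + m))
      regroup = solve 3 (λ i m c → i :+ c :+ (con 8 :+ m) := con 8 :+ (c :+ (i :+ m))) refl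
      regroup₀ : ∀ i m → i + (8 + m) ≡ 8 + (i + m)
      regroup₀ = solve 2 (λ i m → i :+ (con 8 :+ m) := con 8 :+ (i :+ m)) refl

    excess≢0 : n % 6 ≡ 3 → Σ< n e ≢ 0
    excess≢0 n%6≡3 total = three-periodic-not-tight per (tight total)
      where
      open ≡-Reasoning
      multiple : ∀ q i → b (i + q * 6) ≡ b i
      multiple zero    i = cong b (+-identityʳ i)
      multiple (suc q) i = trans (cong b (sym (+-assoc i 6 (q * 6)))) (trans (multiple q (i + 6)) (six-periodic total i))
      per : Periodic 3 b
      per i = begin
        b (i + 3)                      ≡⟨ multiple (n / 6) (i + 3) ⟨
        b (i + 3 + n / 6 * 6)          ≡⟨ cong b (+-assoc i 3 _) ⟩
        b (i + (3 + n / 6 * 6))        ≡⟨ cong (λ r → b (i + (r + n / 6 * 6))) n%6≡3 ⟨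
        b (i + (n % 6 + n / 6 * 6))    ≡⟨ cong (λ k → b (i + k)) (m≡m%n+[m/n]*n n 6) ⟨
        b (i + n)                      ≡⟨ b-periodic i ⟩
        b i                            ∎

    n≤3*weight : n ≤ 3 * Σ< n (bit ∘ b)
    n≤3*weight = subst (n ≤_) weight-excess (m≤m+n n _)

    -- Since 3 divides `n + Σ< n e`, total excess 0 leaves only `n % 6 ≡ 3`, which `excess≢0`
    -- refutes, and total excess 2 forces an ordinary residue. Total excess 1 is refuted by
    -- `excess≢1`.
    n+3≤3*weight : ¬ Ordinary (n % 6) → n + 3 ≤ 3 * Σ< n (bit ∘ b)
    n+3≤3*weight exceptional = subst (n + 3 ≤_) weight-excess (+-monoʳ-≤ n three≤)
      where
      c = Σ< n (bit ∘ b)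
      -- From `n + r ≡ 0` modulo 3 follows `n ≡ -r ≡ r + r`; doubling avoids negation.
      residue : ∀ r → n + r ≡ 3 * c → n % 6 % 3 ≡ (r + r) % 3
      residue r eq = begin
        n % 6 % 3              ≡⟨ m∣n⇒o%n%m≡o%m 3 6 n (divides 2 refl) ⟩
        n % 3                  ≡⟨ [m+kn]%n≡m%n n r 3 ⟨
        (n + r * 3) % 3        ≡⟨ cong (_% 3) (regroup n r) ⟩
        (r + r + (n + r)) % 3  ≡⟨ cong (λ k → (r + r + k) % 3) (trans eq (*-comm 3 c)) ⟩
        (r + r + c * 3) % 3    ≡⟨ [m+kn]%n≡m%n (r + r) c 3 ⟩
        (r + r) % 3            ∎
        where
        open ≡-Reasoning
        open +-*-Solver
        regroup : ∀ n r → n + r * 3 ≡ r + r + (n + r)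
        regroup = solve 2 (λ n r → n :+ r :* con 3 := r :+ r :+ (n :+ r)) refl
      -- The length 13, out of reach of `excess≢1`, has the ordinary residue 1.
      n≢13 : 13 ≢ n
      n≢13 refl = exceptional (inj₂ (inj₁ refl))
      zero-case : ∀ r → r < 6 → r % 3 ≡ 0 → ¬ Ordinary r → r ≡ 3
      zero-case 0 _ _ exc = ⊥-elim (exc (inj₁ refl))
      zero-case 3 _ _ _   = refl
      zero-case (suc (suc (suc (suc (suc (suc _)))))) (s≤s (s≤s (s≤s (s≤s (s≤s (s≤s ())))))) _ _
      two-case : ∀ r → r < 6 → r % 3 ≡ 1 → Ordinary r
      two-case 1 _ _ = inj₂ (inj₁ refl)
      two-case 4 _ _ = inj₂ (inj₂ refl)
      two-case (suc (suc (suc (suc (suc (suc _)))))) (s≤s (s≤s (s≤s (s≤s (s≤s (s≤s ())))))) _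
      balanced : ∀ {E} → Σ< n e ≡ E → n + E ≡ 3 * c
      balanced total = subst (λ E → n + E ≡ 3 * c) total weight-excess
      three≤ : 3 ≤ Σ< n e
      three≤ with Σ< n e in total
      ... | 0 = ⊥-elim (excess≢0 (zero-case (n % 6) (m%n<n n 6) (residue 0 (balanced total)) exceptional) total)
      ... | 1 = ⊥-elim (excess≢1 (≤∧≢⇒< 13≤n n≢13) total)
      ... | 2 = ⊥-elim (exceptional (two-case (n % 6) (m%n<n n 6) (residue 2 (balanced total))))
      ... | suc (suc (suc _)) = s≤s (s≤s (s≤s z≤n))

-- Computation of the potential

-- The potential is tabulated, so that each level of the iteration is evaluated only once.
data Trie : ℕ → Set where
  leaf : ℕ → Trie 0
  node : ∀ {m} → Trie m → Trie m → Trie (suc m)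

build : ∀ m → (Vec Bool m → ℕ) → Trie m
build zero    f = leaf (f [])
build (suc m) f = node (build m (f ∘ (false ∷_))) (build m (f ∘ (true ∷_)))

search : ∀ {m} → Trie m → Vec Bool m → ℕ
search (leaf k)   []          = k
search (node l r) (false ∷ v) = search l v
search (node l r) (true ∷ v)  = search r v

dropLast : ∀ {m} → Vec Bool (suc m) → Vec Bool m
dropLast (x ∷ [])    = []
dropLast (x ∷ y ∷ v) = x ∷ dropLast (y ∷ v)

-- A round of Bellman-Ford relaxation over the two candidate predecessors `dropLast (x ∷ s)` of `s`.
-- A fixed point satisfies the inequality tested by `isPotential`; the value 0 stands for the empty
-- walk.
relax : (State → ℕ) → State → ℕ
relax Q s = via false ⊔ via true
  where
  via : Bool → ℕ
  via x = if legal (x ∷ s) then Q (dropLast (x ∷ s)) + 1 ∸ 3 * bit x else 0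

-- deficits k is the greatest value of (length) - 3 (number of codewords passed) over the legal
-- walks of length at most k into a state; it is stationary from k = 10 on.
deficits : ℕ → Trie 10
deficits zero    = build 10 (λ _ → 0)
deficits (suc k) = build 10 (relax (search (deficits k)))

-- All 1024 states are checked by evaluation. The implications in `paths` cut off a branch as soon
-- as legality or the prescribed excess fails.
certificate : allVec 10 (certified (search (deficits 10))) ≡ true
certificate = refl

legal⇒discharging : ∀ {b} → Legal b → Discharging b
legal⇒discharging = LegalSequence.discharging (search (deficits 10))
  (allVec⁻ 10 (certified (search (deficits 10))) certificate)

-- Locating-dominating codes as hitting sets

-- N[u] is listed from the position u - 3, so that no subtraction is needed.
offsets : List ℕ
offsets = 0 ∷ 2 ∷ 3 ∷ 4 ∷ 6 ∷ []

near : ℕ → ℕ → Bool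
near d j = any (λ e → d + e ≡ᵇ j) offsets

separates : ℕ → ℕ → Bool
separates d j = (j ≡ᵇ 3) ∨ (j ≡ᵇ 3 + d) ∨ (near 0 j xor near d j)

-- A code separates u from u + d, or contains one of them, iff it hits this set shifted by u - 3.
separators : ℕ → List ℕ
separators d = filter (λ j → T? (separates d j)) (upTo 13)

-- Distances 1 to 6 suffice: vertices whose closed neighbourhoods meet differ by at most 6 around
-- the cycle, and disjoint neighbourhoods are separated by domination.
good : (ℕ → Bool) → ℕ → Bool
good b i = hits offsets b i ∧ all (λ k → hits (separators (suc k)) b i) (upTo 6)

hits⁺ : ∀ S b i {j} → j ∈ˡ S → T (b (j + i)) → T (hits S b i)
hits⁺ S b i j∈S h = any⁺ (λ j → b (j + i)) (lose j∈S h)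

hits⁻ : ∀ S b i → T (hits S b i) → ∃[ j ] j ∈ˡ S × T (b (j + i))
hits⁻ S b i h = find (any⁻ (λ j → b (j + i)) S h)

near⁺ : ∀ d {e} → e ∈ˡ offsets → T (near d (d + e))
near⁺ d {e} e∈ = any⁺ (λ e′ → d + e′ ≡ᵇ d + e) (lose e∈ (≡⇒≡ᵇ (d + e) (d + e) refl))

near⁻ : ∀ d j → T (near d j) → ∃[ e ] e ∈ˡ offsets × d + e ≡ j
near⁻ d j h with e , e∈ , eq ← find (any⁻ (λ e → d + e ≡ᵇ j) offsets h) = e , e∈ , ≡ᵇ⇒≡ (d + e) j eq

xor⁺ : ∀ {x y} → (T x × ¬ T y) ⊎ (¬ T x × T y) → T (x xor y)
xor⁺ {true}  {true}  (inj₁ (_ , ¬y)) = ⊥-elim (¬y tt)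
xor⁺ {true}  {false} _               = tt
xor⁺ {true}  {true}  (inj₂ (¬x , _)) = ⊥-elim (¬x tt)
xor⁺ {false} {true}  _               = tt
xor⁺ {false} {false} (inj₁ (() , _))
xor⁺ {false} {false} (inj₂ (_ , ()))

xor⁻ : ∀ {x y} → T (x xor y) → (T x × ¬ T y) ⊎ (¬ T x × T y)
xor⁻ {true}  {false} _ = inj₁ (tt , λ ())
xor⁻ {false} {true}  _ = inj₂ ((λ ()) , tt)

separators⁺ : ∀ d {j} → j < 13 → j ≡ 3 ⊎ j ≡ 3 + d ⊎ T (near 0 j xor near d j) → j ∈ˡ separators d
separators⁺ d {j} j<13 h = ∈-filter⁺ (λ j → T? (separates d j)) (∈-upTo⁺ j<13) (from T-∨ (cases h))
  where
  cases : j ≡ 3 ⊎ j ≡ 3 + d ⊎ T (near 0 j xor near d j) →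
          T (j ≡ᵇ 3) ⊎ T ((j ≡ᵇ 3 + d) ∨ (near 0 j xor near d j))
  cases (inj₁ eq)        = inj₁ (≡⇒≡ᵇ j 3 eq)
  cases (inj₂ (inj₁ eq)) = inj₂ (from T-∨ (inj₁ (≡⇒≡ᵇ j (3 + d) eq)))
  cases (inj₂ (inj₂ x))  = inj₂ (from (T-∨ {j ≡ᵇ 3 + d}) (inj₂ x))

separators⁻ : ∀ d {j} → j ∈ˡ separators d → j < 13 × (j ≡ 3 ⊎ j ≡ 3 + d ⊎ T (near 0 j xor near d j))
separators⁻ d {j} j∈ = ∈-upTo⁻ (proj₁ split) , cases (to T-∨ (proj₂ split))
  where
  split = ∈-filter⁻ (λ j → T? (separates d j)) {xs = upTo 13} j∈
  cases : T (j ≡ᵇ 3) ⊎ T ((j ≡ᵇ 3 + d) ∨ (near 0 j xor near d j)) →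
          j ≡ 3 ⊎ j ≡ 3 + d ⊎ T (near 0 j xor near d j)
  cases (inj₁ eq) = inj₁ (≡ᵇ⇒≡ j 3 eq)
  cases (inj₂ h) with to (T-∨ {j ≡ᵇ 3 + d}) h
  ... | inj₁ eq = inj₂ (inj₁ (≡ᵇ⇒≡ j (3 + d) eq))
  ... | inj₂ x  = inj₂ (inj₂ x)

offsets≤6 : ∀ {e} → e ∈ˡ offsets → e ≤ 6
offsets≤6 e∈ = ≤ᵇ⇒≤ _ 6 (All.lookup (all⁺ (_≤ᵇ 6) offsets tt) e∈)

good⁺ : ∀ b i → T (hits offsets b i) → (∀ k → k < 6 → T (hits (separators (suc k)) b i)) → T (good b i)
good⁺ b i dom sep = from T-∧ (dom , all⁻ _ (All.tabulate (λ {k} k∈ → sep k (∈-upTo⁻ k∈))))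

good-dominates : ∀ b i → T (good b i) → T (hits offsets b i)
good-dominates b i h = proj₁ (to T-∧ h)

good-separates : ∀ b i → T (good b i) → ∀ k → k < 6 → T (hits (separators (suc k)) b i)
good-separates b i h k k<6 =
  All.lookup (all⁺ (λ k → hits (separators (suc k)) b i) (upTo 6) (proj₂ (to (T-∧ {hits offsets b i}) h))) (∈-upTo⁺ k<6)

good⇒legal : ∀ b i → T (good b i) → T (legal (window b i 11))
good⇒legal b i h = from (T-∧ {hits offsets b i}) (good-dominates b i h ,
  -- The arguments 1 and 3 stand for the distances 2 and 4.
  from (T-∧ {hits (separators 2) b i}) (good-separates b i h 1 (s≤s (s≤s z≤n)) ,
    good-separates b i h 3 (s≤s (s≤s (s≤s (s≤s z≤n))))))

∣∣≡Σ< : ∀ {m} (C : Subset m) f → (∀ k → lookup C k ≡ f (toℕ k)) → ∣ C ∣ ≡ Σ< m (bit ∘ f)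
∣∣≡Σ< []          f eq = refl
∣∣≡Σ< (false ∷ C) f eq = cong₂ _+_ (cong bit (eq fzero)) (∣∣≡Σ< C (f ∘ suc) (eq ∘ fsuc))
∣∣≡Σ< (true ∷ C)  f eq = cong₂ _+_ (cong bit (eq fzero)) (∣∣≡Σ< C (f ∘ suc) (eq ∘ fsuc))

x+[y+z] : ∀ x y z → x + (y + z) ≡ y + x + z
x+[y+z] x y z = trans (sym (+-assoc x y z)) (cong (_+ z) (+-comm x y))

-- Residues, neighbourhoods and codes in the circulant graph

module Circulant (n : ℕ) .{{_ : NonZero n}} (13≤n : 13 ≤ n) where

  small : ∀ {k} → k ≤ 12 → k < n
  small k≤12 = ≤-trans (s≤s k≤12) 13≤n

  +-%ˡ : ∀ a k → (a % n + k) % n ≡ (a + k) % n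
  +-%ˡ a k = begin
    (a % n + k) % n          ≡⟨ %-distribˡ-+ (a % n) k n ⟩
    (a % n % n + k % n) % n  ≡⟨ cong (λ r → (r + k % n) % n) (m%n%n≡m%n a n) ⟩
    (a % n + k % n) % n      ≡⟨ %-distribˡ-+ a k n ⟨
    (a + k) % n              ∎
    where open ≡-Reasoning

  %-cancelʳ-+ : ∀ x y a → (x + a) % n ≡ (y + a) % n → x % n ≡ y % n
  %-cancelʳ-+ x y a eq = begin
    x % n                  ≡⟨ absorb x ⟨
    (x + a + c) % n        ≡⟨ +-%ˡ (x + a) c ⟨
    ((x + a) % n + c) % n  ≡⟨ cong (λ r → (r + c) % n) eq ⟩
    ((y + a) % n + c) % n  ≡⟨ +-%ˡ (y + a) c ⟩
    (y + a + c) % n        ≡⟨ absorb y ⟩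
    y % n                  ∎
    where
    open ≡-Reasoning
    -- An additive inverse of `a` modulo `n`.
    c = n ∸ a % n
    a+c : a + c ≡ suc (a / n) * n
    a+c = begin
      a + c                        ≡⟨ cong (_+ c) (m≡m%n+[m/n]*n a n) ⟩
      a % n + a / n * n + c        ≡⟨ cong (_+ c) (+-comm (a % n) _) ⟩
      a / n * n + a % n + c        ≡⟨ +-assoc (a / n * n) (a % n) c ⟩
      a / n * n + (a % n + c)      ≡⟨ cong (a / n * n +_) (m+[n∸m]≡n (m%n≤n a n)) ⟩
      a / n * n + n                ≡⟨ +-comm _ n ⟩
      suc (a / n) * n              ∎
    absorb : ∀ x → (x + a + c) % n ≡ x % n
    absorb x = trans (cong (_% n) (trans (+-assoc x a c) (cong (x +_) a+c))) ([m+kn]%n≡m%n x (suc (a / n)) n)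

  toℕ-mod : ∀ a → toℕ (a mod n) ≡ a % n
  toℕ-mod a = toℕ-fromℕ< (m%n<n a n)

  mod-cong : ∀ {a c} → a % n ≡ c % n → a mod n ≡ c mod n
  mod-cong {a} {c} eq = toℕ-injective (trans (toℕ-mod a) (trans eq (sym (toℕ-mod c))))

  mod⇒% : ∀ {a c} → a mod n ≡ c mod n → a % n ≡ c % n
  mod⇒% {a} {c} eq = trans (sym (toℕ-mod a)) (trans (cong toℕ eq) (toℕ-mod c))

  mod-cancelˡ : ∀ z {a c} → (z + a) mod n ≡ (z + c) mod n → a mod n ≡ c mod n
  mod-cancelˡ z {a} {c} eq = mod-cong (%-cancelʳ-+ a c z
    (trans (cong (_% n) (+-comm a z)) (trans (mod⇒% {z + a} {z + c} eq) (cong (_% n) (+-comm z c)))))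

  mod-congˡ : ∀ z {a c} → a mod n ≡ c mod n → (z + a) mod n ≡ (z + c) mod n
  mod-congˡ z {a} {c} eq = mod-cong (begin
    (z + a) % n      ≡⟨ cong (_% n) (+-comm z a) ⟩
    (a + z) % n      ≡⟨ +-%ˡ a z ⟨
    (a % n + z) % n  ≡⟨ cong (λ r → (r + z) % n) (mod⇒% {a} {c} eq) ⟩
    (c % n + z) % n  ≡⟨ +-%ˡ c z ⟩
    (c + z) % n      ≡⟨ cong (_% n) (+-comm c z) ⟩
    (z + c) % n      ∎)
    where open ≡-Reasoning

  -- As `13 ≤ n`, the 13 positions of a window are distinct vertices, so congruences between them
  -- become equalities of offsets.
  mod-injective : ∀ {x y} a → x ≤ 12 → y ≤ 12 → (x + a) mod n ≡ (y + a) mod n → x ≡ y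
  mod-injective {x} {y} a x≤ y≤ eq = begin
    x      ≡⟨ m<n⇒m%n≡m (small x≤) ⟨
    x % n  ≡⟨ %-cancelʳ-+ x y a (mod⇒% {x + a} {y + a} eq) ⟩
    y % n  ≡⟨ m<n⇒m%n≡m (small y≤) ⟩
    y      ∎
    where open ≡-Reasoning

  toℕ-mod-inverse : ∀ (u : Fin n) → toℕ u mod n ≡ u
  toℕ-mod-inverse u = toℕ-injective (trans (toℕ-mod (toℕ u)) (m<n⇒m%n≡m (toℕ<n u)))

  centre : ∀ (u : Fin n) → ∃[ a ] u ≡ (3 + a) mod n
  centre u = toℕ u + (n ∸ 3) , (begin
    u                               ≡⟨ toℕ-mod-inverse u ⟨
    toℕ u mod n                     ≡⟨ mod-cong ([m+n]%n≡m%n (toℕ u) n) ⟨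
    (toℕ u + n) mod n               ≡⟨ cong (λ k → (toℕ u + k) mod n) (m+[n∸m]≡n 3≤n) ⟨
    (toℕ u + (3 + (n ∸ 3))) mod n   ≡⟨ cong (_mod n) (x+[3+y] (toℕ u) (n ∸ 3)) ⟩
    (3 + (toℕ u + (n ∸ 3))) mod n   ∎)
    where
    open ≡-Reasoning
    3≤n : 3 ≤ n
    3≤n = <⇒≤ (small (s≤s (s≤s (s≤s z≤n))))
    x+[3+y] : ∀ x y → x + (3 + y) ≡ 3 + (x + y)
    x+[3+y] x y = trans (+-suc x _) (cong suc (trans (+-suc x _) (cong suc (+-suc x y))))

  forward : ∀ a k → (toℕ ((3 + a) mod n) + k) % n ≡ toℕ ((k + (3 + a)) mod n)
  forward a k = begin
    (toℕ ((3 + a) mod n) + k) % n  ≡⟨ cong (λ r → (r + k) % n) (toℕ-mod (3 + a)) ⟩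
    ((3 + a) % n + k) % n          ≡⟨ +-%ˡ (3 + a) k ⟩
    (3 + a + k) % n                ≡⟨ cong (_% n) (+-comm (3 + a) k) ⟩
    (k + (3 + a)) % n              ≡⟨ toℕ-mod (k + (3 + a)) ⟨
    toℕ ((k + (3 + a)) mod n)      ∎
    where open ≡-Reasoning

  -- The neighbour `k` to the left of position `3 + a` has offset `j = 3 - k` in the listing from
  -- `a`.
  backward : ∀ a k j → k + j ≡ 3 → (toℕ ((3 + a) mod n) + (n ∸ k % n)) % n ≡ toℕ ((j + a) mod n)
  backward a k j k+j≡3 = begin
    (toℕ ((3 + a) mod n) + (n ∸ k % n)) % n  ≡⟨ forward a (n ∸ k % n) ⟩
    toℕ ((n ∸ k % n + (3 + a)) mod n)        ≡⟨ cong toℕ (mod-cong (trans (cong (_% n) shift) ([m+n]%n≡m%n (j + a) n))) ⟩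
    toℕ ((j + a) mod n)                      ∎
    where
    open ≡-Reasoning
    k<n : k < n
    k<n = small (≤-trans (subst (k ≤_) k+j≡3 (m≤m+n k j)) (s≤s (s≤s (s≤s z≤n))))
    shift : n ∸ k % n + (3 + a) ≡ j + a + n
    shift = begin
      n ∸ k % n + (3 + a)    ≡⟨ cong₂ (λ r t → n ∸ r + (t + a)) (m<n⇒m%n≡m k<n) (sym k+j≡3) ⟩
      n ∸ k + (k + j + a)    ≡⟨ cong (n ∸ k +_) (+-assoc k j a) ⟩
      n ∸ k + (k + (j + a))  ≡⟨ +-assoc (n ∸ k) k (j + a) ⟨
      n ∸ k + k + (j + a)    ≡⟨ cong (_+ (j + a)) (m∸n+n≡m (<⇒≤ k<n)) ⟩
      n + (j + a)            ≡⟨ +-comm n (j + a) ⟩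
      j + a + n              ∎

  self : ∀ a → toℕ ((3 + a) mod n) % n ≡ toℕ ((3 + a) mod n)
  self a = trans (cong (_% n) (toℕ-mod (3 + a))) (trans (m%n%n≡m%n (3 + a) n) (sym (toℕ-mod (3 + a))))

  nbhd⁺ : ∀ a {j} → j ∈ˡ offsets → InClosedNbhd n ((3 + a) mod n) ((j + a) mod n)
  nbhd⁺ a (here refl)                                 = inj₂ (inj₂ (inj₂ (inj₂ (sym (backward a 3 0 refl)))))
  nbhd⁺ a (there (here refl))                         = inj₂ (inj₂ (inj₁ (sym (backward a 1 2 refl))))
  nbhd⁺ a (there (there (here refl)))                 = inj₁ (sym (self a))
  nbhd⁺ a (there (there (there (here refl))))         = inj₂ (inj₁ (sym (forward a 1)))
  nbhd⁺ a (there (there (there (there (here refl))))) = inj₂ (inj₂ (inj₂ (inj₁ (sym (forward a 3)))))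

  nbhd⁻ : ∀ a {v} → InClosedNbhd n ((3 + a) mod n) v → ∃[ j ] j ∈ˡ offsets × v ≡ (j + a) mod n
  nbhd⁻ a (inj₁ eq)                      = 3 , there (there (here refl)) , toℕ-injective (trans eq (self a))
  nbhd⁻ a (inj₂ (inj₁ eq))               = 4 , there (there (there (here refl))) , toℕ-injective (trans eq (forward a 1))
  nbhd⁻ a (inj₂ (inj₂ (inj₁ eq)))        = 2 , there (here refl) , toℕ-injective (trans eq (backward a 1 2 refl))
  nbhd⁻ a (inj₂ (inj₂ (inj₂ (inj₁ eq)))) = 6 , there (there (there (there (here refl)))) , toℕ-injective (trans eq (forward a 3))
  nbhd⁻ a (inj₂ (inj₂ (inj₂ (inj₂ eq)))) = 0 , here refl , toℕ-injective (trans eq (backward a 3 0 refl))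

  nbhd? : ∀ u v → Dec (InClosedNbhd n u v)
  nbhd? u v = (_ ≟ _) ⊎-dec (_ ≟ _) ⊎-dec (_ ≟ _) ⊎-dec (_ ≟ _) ⊎-dec (_ ≟ _)

  nbhd⇒near : ∀ a d j → d ≤ 6 → j ≤ 12 → InClosedNbhd n ((3 + (d + a)) mod n) ((j + a) mod n) → T (near d j)
  nbhd⇒near a d j d≤6 j≤12 h = let e , e∈ , eq = nbhd⁻ (d + a) h in
    subst (T ∘ near d)
      (sym (mod-injective a j≤12 (+-mono-≤ d≤6 (offsets≤6 e∈)) (trans eq (cong (_mod n) (x+[y+z] e d a)))))
      (near⁺ d e∈)

  near⇒nbhd : ∀ a d j → T (near d j) → InClosedNbhd n ((3 + (d + a)) mod n) ((j + a) mod n)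
  near⇒nbhd a d j h = let e , e∈ , eq = near⁻ d j h in
    subst (InClosedNbhd n ((3 + (d + a)) mod n))
      (cong (_mod n) (trans (x+[y+z] e d a) (cong (_+ a) eq)))
      (nbhd⁺ (d + a) e∈)

  module _ (C : Subset n) where

    seq : ℕ → Bool
    seq i = lookup C (i mod n)

    seq-periodic : Periodic n seq
    seq-periodic i = cong (lookup C) (mod-cong ([m+n]%n≡m%n i n))

    ∣∣≡weight : ∣ C ∣ ≡ Σ< n (bit ∘ seq)
    ∣∣≡weight = ∣∣≡Σ< C seq (λ u → cong (lookup C) (sym (toℕ-mod-inverse u)))

    ∈⇒T : ∀ {v} i → v ≡ i mod n → v ∈ C → T (seq i)
    ∈⇒T i refl v∈C = subst T (sym ([]=⇒lookup v∈C)) tt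

    T⇒∈ : ∀ i → T (seq i) → i mod n ∈ C
    T⇒∈ i h = lookup⇒[]= (i mod n) C (to T-≡ h)

    ld⇒good : IsLocatingDominating n C → ∀ i → T (good seq i)
    ld⇒good (_ , dominated , separated) i =
      good⁺ seq i (dominates (dominated ((3 + i) mod n))) λ k k<6 → distinguishes (suc k) z<s k<6
      where
      dominates : Dominated n C ((3 + i) mod n) → T (hits offsets seq i)
      dominates (v , nb , v∈C) = let j , j∈ , eq = nbhd⁻ i nb in hits⁺ offsets seq i j∈ (∈⇒T (j + i) eq v∈C)

      module _ (d : ℕ) (0<d : 0 < d) (d≤6 : d ≤ 6) where
        U = (3 + i) mod n
        W = (3 + (d + i)) mod n

        witness : ∀ {j} → j ≤ 12 → j ≡ 3 ⊎ j ≡ 3 + d ⊎ T (near 0 j xor near d j) →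
                  T (seq (j + i)) → T (hits (separators d) seq i)
        witness j≤12 h = hits⁺ (separators d) seq i (separators⁺ d (s≤s j≤12) h)

        3+d≤12 : 3 + d ≤ 12
        3+d≤12 = ≤-trans (+-monoʳ-≤ 3 d≤6) (m≤m+n 9 3)

        U≢W : U ≢ W
        U≢W eq = <⇒≢ 0<d (+-cancelˡ-≡ 3 0 d (mod-injective i (m≤m+n 3 9) 3+d≤12 eq))

        fromSeparated : Separated n C U W → T (hits (separators d) seq i)
        fromSeparated (v , v∈C , inj₁ (nU , ¬nW)) with j , j∈ , refl ← nbhd⁻ i nU =
          witness j≤12 (inj₂ (inj₂ (xor⁺ (inj₁ (near⁺ 0 j∈ , λ h → ¬nW (near⇒nbhd i d j h)))))) (∈⇒T (j + i) refl v∈C)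
          where
          j≤12 : j ≤ 12
          j≤12 = ≤-trans (offsets≤6 j∈) (m≤m+n 6 6)
        fromSeparated (v , v∈C , inj₂ (¬nU , nW)) with e , e∈ , refl ← nbhd⁻ (d + i) nW =
          witness (+-mono-≤ d≤6 (offsets≤6 e∈))
            (inj₂ (inj₂ (xor⁺ (inj₂
              ((λ h → ¬nU (subst (InClosedNbhd n U) (sym eq) (near⇒nbhd i 0 (d + e) h))) , near⁺ d e∈)))))
            (∈⇒T (d + e + i) eq v∈C)
          where
          eq : (e + (d + i)) mod n ≡ (d + e + i) mod n
          eq = cong (_mod n) (x+[y+z] e d i)

        distinguishes : T (hits (separators d) seq i)
        -- A codeword at `U` or `W` is hit through offset 3 or `3 + d`; otherwise both lie outside
        -- the code and the hypothesis separates them.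
        distinguishes with T? (seq (3 + i)) | T? (seq (3 + (d + i)))
        ... | yes h | _     = witness (m≤m+n 3 9) (inj₁ refl) h
        ... | no _  | yes h = witness 3+d≤12 (inj₂ (inj₁ refl)) h
        ... | no ¬u | no ¬w = fromSeparated
          (separated U W (λ h → ¬u (∈⇒T (3 + i) refl h)) (λ h → ¬w (∈⇒T (3 + (d + i)) refl h)) U≢W)

    separated-sym : ∀ {u w} → Separated n C u w → Separated n C w u
    separated-sym (v , v∈C , inj₁ (nu , ¬nw)) = v , v∈C , inj₂ (¬nw , nu)
    separated-sym (v , v∈C , inj₂ (¬nu , nw)) = v , v∈C , inj₁ (nw , ¬nu)

    module _ (all-good : ∀ i → T (good seq i)) where

      dominated : ∀ u → Dominated n C u
      dominated u with a , refl ← centre u =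
        let j , j∈ , h = hits⁻ offsets seq a (good-dominates seq a (all-good a)) in (j + a) mod n , nbhd⁺ a j∈ , T⇒∈ (j + a) h

      near-separated : ∀ a k → k < 6 → (3 + a) mod n ∉ C → (3 + (suc k + a)) mod n ∉ C →
                       Separated n C ((3 + a) mod n) ((3 + (suc k + a)) mod n)
      near-separated a k k<6 u∉C w∉C
        with j , j∈ , h ← hits⁻ (separators (suc k)) seq a (good-separates seq a (all-good a) k k<6)
        with separators⁻ (suc k) j∈
      ... | _ , inj₁ refl        = ⊥-elim (u∉C (T⇒∈ (3 + a) h))
      ... | _ , inj₂ (inj₁ refl) = ⊥-elim (w∉C (T⇒∈ (3 + (suc k + a)) h))
      ... | s≤s j≤12 , inj₂ (inj₂ x) = (j + a) mod n , T⇒∈ (j + a) h , cases (xor⁻ x)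
        where
        cases : (T (near 0 j) × ¬ T (near (suc k) j)) ⊎ (¬ T (near 0 j) × T (near (suc k) j)) → _
        cases (inj₁ (n₀ , ¬n₁)) = inj₁ (near⇒nbhd a 0 j n₀ , ¬n₁ ∘ nbhd⇒near a (suc k) j k<6 j≤12)
        cases (inj₂ (¬n₀ , n₁)) = inj₂ (¬n₀ ∘ nbhd⇒near a 0 j z≤n j≤12 , near⇒nbhd a (suc k) j n₁)

      shifted-separated : ∀ {u w} a c k → k < 6 → u ≡ (3 + a) mod n → w ≡ (3 + c) mod n → (suc k + a) mod n ≡ c mod n →
                          u ∉ C → w ∉ C → Separated n C u w
      shifted-separated a c k k<6 refl w≡ eq u∉C w∉C =
        subst (Separated n C ((3 + a) mod n)) w′≡w (near-separated a k k<6 u∉C (subst (_∉ C) (sym w′≡w) w∉C))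
        where
        w′≡w = trans (mod-congˡ 3 {suc k + a} {c} eq) (sym w≡)

      -- A codeword `v` dominating `u` either separates it from `w` or is near both. In the latter
      -- case `v` has offset `e` from `u - 3` and `f` from `w - 3`, so `u` and `w` differ by at most
      -- 6 and a distance test applies.
      separated : ∀ u w → u ∉ C → w ∉ C → u ≢ w → Separated n C u w
      separated u w u∉C w∉C u≢w with v , nu , v∈C ← dominated u with nbhd? w v
      ... | no ¬nw = v , v∈C , inj₁ (nu , ¬nw)
      ... | yes nw = let a , u≡ = centre u; c , w≡ = centre w
                         e , e∈ , v≡e+a = nbhd⁻ a (subst (λ u → InClosedNbhd n u v) u≡ nu)
                         f , f∈ , v≡f+c = nbhd⁻ c (subst (λ w → InClosedNbhd n w v) w≡ nw)
                     in cases a c e f u≡ w≡ (offsets≤6 e∈) (offsets≤6 f∈) (trans (sym v≡e+a) v≡f+c)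
        where
        split : ∀ x y z → suc (x + y) + z ≡ x + (suc y + z)
        split x y z = trans (cong (_+ z) (sym (+-suc x y))) (+-assoc x (suc y) z)
        cases : ∀ a c e f → u ≡ (3 + a) mod n → w ≡ (3 + c) mod n → e ≤ 6 → f ≤ 6 →
                (e + a) mod n ≡ (f + c) mod n → Separated n C u w
        cases a c e f u≡ w≡ e≤6 f≤6 eq with compare e f
        ... | equal e = ⊥-elim (u≢w (trans u≡ (trans (mod-congˡ 3 {a} {c} (mod-cancelˡ e eq)) (sym w≡))))
        -- Here `f` is `suc (e + k)`, so `u` lies `suc k` ahead of `w` and the pair is treated in
        -- the opposite order.
        ... | less e k = separated-sym (shifted-separated c a k (≤-trans (s≤s (m≤n+m k e)) f≤6) w≡ u≡
          (sym (mod-cancelˡ e (trans eq (cong (_mod n) (split e k c))))) w∉C u∉C)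
        ... | greater f k = shifted-separated a c k (≤-trans (s≤s (m≤n+m k f)) e≤6) u≡ w≡
          (mod-cancelˡ f (trans (cong (_mod n) (sym (split f k a))) eq)) u∉C w∉C

      good⇒ld : IsLocatingDominating n C
      good⇒ld = (let v , _ , v∈C = dominated (0 mod n) in v , v∈C) , dominated , separated

-- Codes of optimal size

block : List Bool
block = false ∷ false ∷ true ∷ true ∷ false ∷ false ∷ []

blocks : ℕ → List Bool
blocks m = concat (replicate m block)

-- Indexed by length minus one: the lengths 1 to 6 cover all residues modulo 6, and the catch-all
-- clause serves length 6.
patch : ℕ → List Bool
patch 0 = true ∷ []
patch 1 = true ∷ true ∷ []
patch 2 = true ∷ false ∷ true ∷ []
patch 3 = true ∷ true ∷ false ∷ false ∷ []
patch 4 = true ∷ true ∷ true ∷ false ∷ false ∷ []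
patch _ = block

word : ℕ → ℕ → List Bool
word r m = patch r ++ blocks m

ones : List Bool → ℕ
ones []       = 0
ones (x ∷ xs) = bit x + ones xs

bitAt-++ʳ : ∀ xs {ys} i → bitAt (xs ++ ys) (length xs + i) ≡ bitAt ys i
bitAt-++ʳ []       i = refl
bitAt-++ʳ (x ∷ xs) i = bitAt-++ʳ xs i

bitAt-++ˡ : ∀ xs {ys i} → i < length xs → bitAt (xs ++ ys) i ≡ bitAt xs i
bitAt-++ˡ (x ∷ xs) {i = zero}  _         = refl
bitAt-++ˡ (x ∷ xs) {i = suc i} (s≤s i<n) = bitAt-++ˡ xs i<n

Σ<-bitAt : ∀ xs → Σ< (length xs) (bit ∘ bitAt xs) ≡ ones xs
Σ<-bitAt []       = refl
Σ<-bitAt (x ∷ xs) = cong (bit x +_) (Σ<-bitAt xs)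

hits-cong : ∀ S b b′ i i′ → (∀ {j} → j ∈ˡ S → j < 13) → (∀ j → j < 13 → b (j + i) ≡ b′ (j + i′)) →
            T (hits S b i) → T (hits S b′ i′)
hits-cong S b b′ i i′ bound eq h =
  let j , j∈ , hj = hits⁻ S b i h in hits⁺ S b′ i′ j∈ (subst T (eq j (bound j∈)) hj)

-- The largest offset tested by `good` is 12, so it reads only the 13 bits from its position on.
good-cong : ∀ b b′ i i′ → (∀ j → j < 13 → b (j + i) ≡ b′ (j + i′)) → T (good b i) → T (good b′ i′)
good-cong b b′ i i′ eq h = good⁺ b′ i′
  (hits-cong offsets b b′ i i′ (λ j∈ → s≤s (≤-trans (offsets≤6 j∈) (m≤m+n 6 6))) eq (good-dominates b i h))
  (λ k k<6 → hits-cong (separators (suc k)) b b′ i i′ (proj₁ ∘ separators⁻ (suc k)) eq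
    (good-separates b i h k k<6))

goodBelow : ℕ → List Bool → Bool
goodBelow k xs = all (good (bitAt xs)) (upTo k)

-- Windows that start in `ys` are checked by evaluation, later ones are inherited from `xs`.
goodBelow-++ : ∀ ys {xs k} → T (goodBelow (length ys) (ys ++ xs)) → (∀ i → i < k → T (good (bitAt xs) i)) →
               ∀ i → i < length ys + k → T (good (bitAt (ys ++ xs)) i)
goodBelow-++ ys {xs} {k} h hxs i i<k with i <? length ys
... | yes i<ys = All.lookup (all⁺ (good (bitAt (ys ++ xs))) (upTo (length ys)) h) (∈-upTo⁺ i<ys)
... | no  i≮ys = good-cong (bitAt xs) (bitAt (ys ++ xs)) (i ∸ length ys) i
  (λ j _ → trans (sym (bitAt-++ʳ ys (j + (i ∸ length ys)))) (cong (bitAt (ys ++ xs)) (shift j)))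
  (hxs (i ∸ length ys) (+-cancelˡ-< (length ys) _ _ (subst (_< length ys + k) (sym ys+i) i<k)))
  where
  ys+i : length ys + (i ∸ length ys) ≡ i
  ys+i = m+[n∸m]≡n (≮⇒≥ i≮ys)
  shift : ∀ j → length ys + (j + (i ∸ length ys)) ≡ j + i
  shift j = trans (x+[y+z] (length ys) j (i ∸ length ys)) (trans (+-assoc j (length ys) (i ∸ length ys)) (cong (j +_) ys+i))

-- A window that starts in the first of three consecutive blocks ends inside the third one.
good-blocks : ∀ {xs} → T (goodBelow 6 (block ++ xs)) → T (goodBelow 6 (block ++ block ++ xs)) →
              ∀ m i → i < m * 6 → T (good (bitAt (blocks m ++ xs)) i)
good-blocks h₁ h₂ 1 = goodBelow-++ block {k = 0} h₁ (λ _ ())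
good-blocks h₁ h₂ 2 = goodBelow-++ block {k = 6} h₂ (good-blocks h₁ h₂ 1)
good-blocks h₁ h₂ (suc (suc (suc m))) = goodBelow-++ block {k = suc (suc m) * 6} tt (good-blocks h₁ h₂ (suc (suc m)))

-- Doubling the word models cyclic reading: a window starting in the first copy ends before the end
-- of the second.
good-word : ∀ r m i → i < length (patch r) + suc (suc m) * 6 →
            T (good (bitAt (word r (suc (suc m)) ++ word r (suc (suc m)))) i)
good-word r m i i< = subst (λ ys → T (good (bitAt ys) i)) (sym (++-assoc (patch r) (blocks (suc (suc m))) (word r (suc (suc m)))))
  (goodBelow-++ (patch r) (seam r) (good-blocks (last r) (penultimate r) (suc (suc m))) i i<)
  where
  -- A window starting in the patch ends within the two blocks exposed by `suc (suc m)`, so each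
  -- case evaluates although `m` is a variable.
  seam : ∀ r → T (goodBelow (length (patch r)) (patch r ++ blocks (suc (suc m)) ++ word r (suc (suc m))))
  seam 0 = tt
  seam 1 = tt
  seam 2 = tt
  seam 3 = tt
  seam 4 = tt
  seam (suc (suc (suc (suc (suc _))))) = tt
  last : ∀ r → T (goodBelow 6 (block ++ word r (suc (suc m))))
  last 0 = tt
  last 1 = tt
  last 2 = tt
  last 3 = tt
  last 4 = tt
  last (suc (suc (suc (suc (suc _))))) = tt
  penultimate : ∀ r → T (goodBelow 6 (block ++ block ++ word r (suc (suc m))))
  penultimate 0 = tt
  penultimate 1 = tt
  penultimate 2 = tt
  penultimate 3 = tt
  penultimate 4 = tt
  penultimate (suc (suc (suc (suc (suc _))))) = tt

length-blocks : ∀ m → length (blocks m) ≡ m * 6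
length-blocks zero    = refl
length-blocks (suc m) = cong (6 +_) (length-blocks m)

length-word : ∀ r m → length (word r m) ≡ length (patch r) + m * 6
length-word r m = trans (length-++ (patch r)) (cong (length (patch r) +_) (length-blocks m))

ones-++ : ∀ xs ys → ones (xs ++ ys) ≡ ones xs + ones ys
ones-++ []       ys = refl
ones-++ (x ∷ xs) ys = trans (cong (bit x +_) (ones-++ xs ys)) (sym (+-assoc (bit x) (ones xs) (ones ys)))

ones-blocks : ∀ m → ones (blocks m) ≡ m * 2
ones-blocks zero    = refl
ones-blocks (suc m) = cong (2 +_) (ones-blocks m)

ones-word : ∀ r m → ones (word r m) ≡ ones (patch r) + m * 2
ones-word r m = trans (ones-++ (patch r) (blocks m)) (cong (ones (patch r) +_) (ones-blocks m))

module WordCode (n : ℕ) .{{_ : NonZero n}} (13≤n : 13 ≤ n)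
                (r m : ℕ) (n≡ : n ≡ length (patch r) + suc (suc m) * 6) where

  open Circulant n 13≤n

  w : List Bool
  w = word r (suc (suc m))

  length-w : length w ≡ n
  length-w = trans (length-word r (suc (suc m))) (sym n≡)

  code : Subset n
  code = tabulate (bitAt w ∘ toℕ)

  seq-code : ∀ i → seq code i ≡ bitAt w (i % n)
  seq-code i = trans (lookup∘tabulate (bitAt w ∘ toℕ) (i mod n)) (cong (bitAt w) (toℕ-mod i))

  bitAt-w++w : ∀ x → x < n + n → bitAt (w ++ w) x ≡ bitAt w (x % n)
  bitAt-w++w x x<2n with x <? n
  ... | yes x<n = trans (bitAt-++ˡ w (subst (x <_) (sym length-w) x<n)) (cong (bitAt w) (sym (m<n⇒m%n≡m x<n)))
  ... | no  x≮n = begin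
    bitAt (w ++ w) x                ≡⟨ cong (bitAt (w ++ w)) (trans (cong (_+ y) length-w) n+y≡x) ⟨
    bitAt (w ++ w) (length w + y)   ≡⟨ bitAt-++ʳ w y ⟩
    bitAt w y                       ≡⟨ cong (bitAt w) (m<n⇒m%n≡m y<n) ⟨
    bitAt w (y % n)                 ≡⟨ cong (bitAt w) ([m+n]%n≡m%n y n) ⟨
    bitAt w ((y + n) % n)           ≡⟨ cong (λ z → bitAt w (z % n)) (trans (+-comm y n) n+y≡x) ⟩
    bitAt w (x % n)                 ∎
    where
    open ≡-Reasoning
    y = x ∸ n
    n+y≡x : n + y ≡ x
    n+y≡x = m+[n∸m]≡n (≮⇒≥ x≮n)
    y<n : y < n
    y<n = +-cancelˡ-< n y n (subst (_< n + n) (sym n+y≡x) x<2n)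

  code-ld : IsLocatingDominating n code
  code-ld = good⇒ld code λ i → good-cong (bitAt (w ++ w)) (seq code) (i % n) i (agree i)
    (good-word r m (i % n) (subst (i % n <_) n≡ (m%n<n i n)))
    where
    agree : ∀ i j → j < 13 → bitAt (w ++ w) (j + i % n) ≡ seq code (j + i)
    agree i j j<13 = begin
      bitAt (w ++ w) (j + i % n)    ≡⟨ bitAt-w++w (j + i % n) (+-mono-< (≤-trans j<13 13≤n) (m%n<n i n)) ⟩
      bitAt w ((j + i % n) % n)     ≡⟨ cong (λ k → bitAt w (k % n)) (+-comm j (i % n)) ⟩
      bitAt w ((i % n + j) % n)     ≡⟨ cong (bitAt w) (+-%ˡ i j) ⟩
      bitAt w ((i + j) % n)         ≡⟨ cong (λ k → bitAt w (k % n)) (+-comm i j) ⟩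
      bitAt w ((j + i) % n)         ≡⟨ seq-code (j + i) ⟨
      seq code (j + i)              ∎
      where open ≡-Reasoning

  ∣code∣ : ∣ code ∣ ≡ ones (patch r) + suc (suc m) * 2
  ∣code∣ = begin
    ∣ code ∣                            ≡⟨ ∣∣≡Σ< code (bitAt w) (lookup∘tabulate (bitAt w ∘ toℕ)) ⟩
    Σ< n (bit ∘ bitAt w)                ≡⟨ cong (λ k → Σ< k (bit ∘ bitAt w)) length-w ⟨
    Σ< (length w) (bit ∘ bitAt w)       ≡⟨ Σ<-bitAt w ⟩
    ones w                              ≡⟨ ones-word r (suc (suc m)) ⟩
    ones (patch r) + suc (suc m) * 2    ∎
    where open ≡-Reasoning

-- Sizes of the codes and combination of the bounds

patch-size : ∀ r → r < 6 → length (patch r) ≡ suc r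
                         × (Ordinary (suc r % 6) → ones (patch r) ≡ (suc r + 2) / 3)
                         × (¬ Ordinary (suc r % 6) → ones (patch r) ≡ (suc r + 2) / 3 + 1)
patch-size 0 _ = refl , (λ _ → refl) , λ ¬o → ⊥-elim (¬o (inj₂ (inj₁ refl)))
patch-size 1 _ = refl , (λ { (inj₁ ()) ; (inj₂ (inj₁ ())) ; (inj₂ (inj₂ ())) }) , λ _ → refl
patch-size 2 _ = refl , (λ { (inj₁ ()) ; (inj₂ (inj₁ ())) ; (inj₂ (inj₂ ())) }) , λ _ → refl
patch-size 3 _ = refl , (λ _ → refl) , λ ¬o → ⊥-elim (¬o (inj₂ (inj₂ refl)))
patch-size 4 _ = refl , (λ { (inj₁ ()) ; (inj₂ (inj₁ ())) ; (inj₂ (inj₂ ())) }) , λ _ → refl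
patch-size 5 _ = refl , (λ _ → refl) , λ ¬o → ⊥-elim (¬o (inj₁ refl))
patch-size (suc (suc (suc (suc (suc (suc _)))))) (s≤s (s≤s (s≤s (s≤s (s≤s (s≤s ()))))))

⌈/3⌉-split : ∀ r m → ⌈ r + m * 6 /3⌉ ≡ (r + 2) / 3 + m * 2
⌈/3⌉-split r m = begin
  (r + m * 6 + 2) / 3          ≡⟨ cong (_/ 3) (regroup r m) ⟩
  (r + 2 + m * 2 * 3) / 3      ≡⟨ +-distrib-/-∣ʳ (r + 2) {m * 2 * 3} (divides (m * 2) refl) ⟩
  (r + 2) / 3 + m * 2 * 3 / 3  ≡⟨ cong ((r + 2) / 3 +_) (m*n/n≡m (m * 2) 3) ⟩
  (r + 2) / 3 + m * 2          ∎
  where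
  open ≡-Reasoning
  open +-*-Solver
  regroup : ∀ r m → r + m * 6 + 2 ≡ r + 2 + m * 2 * 3
  regroup = solve 2 (λ r m → r :+ m :* con 6 :+ con 2 := r :+ con 2 :+ m :* con 2 :* con 3) refl

module _ (n : ℕ) .{{_ : NonZero n}} (13≤n : 13 ≤ n) where

  open Circulant n 13≤n

  lower-bound : ∀ C → IsLocatingDominating n C → ⌈ n /3⌉ ≤ ∣ C ∣ × (¬ Ordinary (n % 6) → ⌈ n /3⌉ + 1 ≤ ∣ C ∣)
  lower-bound C ld =
    -- As `⌈ n /3⌉` is `(n + 2) / 3`, the bound `n ≤ 3 ∣ C ∣` puts it below `suc ∣ C ∣`; in the
    -- exceptional case `n + 3 ≤ 3 ∣ C ∣` puts it below `∣ C ∣`.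
    s≤s⁻¹ (m<n*o⇒m/o<n {n + 2} {suc ∣ C ∣} {3}
      (s≤s (≤-trans (≤-reflexive (+-comm n 2)) (+-monoʳ-≤ 2 (weighted n≤3*weight))))) ,
    λ exceptional → subst (_≤ ∣ C ∣) (+-comm 1 ⌈ n /3⌉)
      (m<n*o⇒m/o<n {n + 2} {∣ C ∣} {3} (≤-trans (≤-reflexive (sym (+-suc n 2))) (weighted (n+3≤3*weight exceptional))))
    where
    discharged : Discharging (seq C)
    discharged = legal⇒discharging (λ i → good⇒legal (seq C) i (ld⇒good C ld i))
    open LowerBound discharged using (module Weight)
    open Weight 13≤n (seq-periodic C)
    weighted : ∀ {k} → k ≤ 3 * Σ< n (bit ∘ seq C) → k ≤ ∣ C ∣ * 3
    weighted {k} k≤ = subst (k ≤_) (trans (cong (3 *_) (sym (∣∣≡weight C))) (*-comm 3 ∣ C ∣)) k≤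

  upper-bound : ∃[ C ] IsLocatingDominating n C
                × (Ordinary (n % 6) → ∣ C ∣ ≡ ⌈ n /3⌉)
                × (¬ Ordinary (n % 6) → ∣ C ∣ ≡ ⌈ n /3⌉ + 1)
  upper-bound = code , code-ld ,
    (λ o → trans ∣code∣ (trans (cong (_+ M * 2) (proj₁ sizes (subst Ordinary n%6 o))) (sym ⌈n/3⌉))) ,
    (λ ¬o → trans ∣code∣ (trans (cong (_+ M * 2) (proj₂ sizes (¬o ∘ subst Ordinary (sym n%6))))
      (trans (move-one q (M * 2)) (cong (_+ 1) (sym ⌈n/3⌉)))))
    where
    open +-*-Solver
    move-one : ∀ q k → q + 1 + k ≡ q + k + 1
    move-one = solve 2 (λ q k → q :+ con 1 :+ k := q :+ k :+ con 1) refl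
    -- Subtracting 13 yields `n = suc r + 6 M` with `r < 6` and the at least two blocks that
    -- `WordCode` asks for.
    r = (n ∸ 13) % 6
    M = 2 + (n ∸ 13) / 6
    q = (suc r + 2) / 3
    n≡r+6M : n ≡ suc r + M * 6
    n≡r+6M = begin
      n                                        ≡⟨ m+[n∸m]≡n 13≤n ⟨
      13 + (n ∸ 13)                            ≡⟨ cong (13 +_) (m≡m%n+[m/n]*n (n ∸ 13) 6) ⟩
      13 + (r + (n ∸ 13) / 6 * 6)              ≡⟨ regroup r ((n ∸ 13) / 6 * 6) ⟩
      suc r + M * 6                            ∎
      where
      open ≡-Reasoning
      regroup : ∀ r k → 13 + (r + k) ≡ suc r + (12 + k)
      regroup = solve 2 (λ r k → con 13 :+ (r :+ k) := con 1 :+ r :+ (con 12 :+ k)) refl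
    patch-r = patch-size r (m%n<n (n ∸ 13) 6)
    sizes = proj₂ patch-r
    n%6 : n % 6 ≡ suc r % 6
    n%6 = trans (cong (_% 6) n≡r+6M) ([m+kn]%n≡m%n (suc r) M 6)
    ⌈n/3⌉ : ⌈ n /3⌉ ≡ q + M * 2
    ⌈n/3⌉ = trans (cong ⌈_/3⌉ n≡r+6M) (⌈/3⌉-split (suc r) M)
    open WordCode n 13≤n r ((n ∸ 13) / 6) (trans n≡r+6M (cong (_+ M * 6) (sym (proj₁ patch-r))))

theorem12 : (n : ℕ) → .{{_ : NonZero n}} → 13 ≤ n →
    ((n % 6 ≡ 0 ⊎ n % 6 ≡ 1 ⊎ n % 6 ≡ 4) → γLD≡ n ⌈ n /3⌉)
    × (¬ (n % 6 ≡ 0 ⊎ n % 6 ≡ 1 ⊎ n % 6 ≡ 4) → γLD≡ n (⌈ n /3⌉ + 1))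
theorem12 n 13≤n = let C , ld , ordinary , exceptional = upper-bound n 13≤n in
  (λ o  → (C , ld , ordinary o) , λ C ld → proj₁ (lower-bound n 13≤n C ld)) ,
  (λ ¬o → (C , ld , exceptional ¬o) , λ C ld → proj₂ (lower-bound n 13≤n C ld) ¬o)
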